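{- Let $G$ be a finite abelian group, let $m$ be a positive integer with $m \leq |G|$, and let $h \geq 2$ be an integer. Then $$\rho_{\pm}(G,m,h) = \min\{ |h_{\pm}A| \; : \; A \in \mathcal{A}(G,m)\}.$$
   Context: $G$ is written additively. For an $m$-subset $A=\{a_1,\dots,a_m\}$ of $G$ (with $m\ge 1$), the $h$-fold signed sumset is $$h_{\pm}A=\Big\{ \sum_{i=1}^m \lambda_i a_i \; : \; (\lambda_1,\dots,\lambda_m)\in\mathbb{Z}^m,\ \sum_{i=1}^m|\lambda_i|=h\Big\}.$$ For a positive integer $m\le |G|$, $\rho_{\pm}(G,m,h)=\min\{|h_{\pm}A| : A\subseteq G,\ |A|=m\}$. For $A \subseteq G$ write $-A=\{ -a : a\in A\}$. A subset $A$ of $G$ is called symmetric if $A=-A$ (the empty set is symmetric); near-symmetric if $A$ is not symmetric but $A\setminus\{a\}$ is symmetric for some $a\in A$; and asymmetric if $A\cap(-A)=\emptyset$. $\mathcal{A}(G,m)$ is the collection of all $m$-element subsets of $G$ that are symmetric, near-symmetric, or asymmetric. -}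

module Defs where

open import Algebra.Bundles using (AbelianGroup)
import Algebra.Properties.CommutativeMonoid.Sum as Summation
import Algebra.Properties.Monoid.Mult as Multiplication
open import Data.Fin.Base using (Fin; zero; suc; toℕ; fromℕ<)
open import Data.Fin.Properties using (any?; suc-injective; toℕ-fromℕ<; toℕ<n)
  renaming (_≟_ to _≟ᶠ_)
open import Data.Fin.Subset
  using (Subset; inside; outside; _∈_; _∩_; _-_; ∣_∣; Empty)
  renaming (⊥ to ∅)
open import Data.Fin.Subset.Properties using (_∈?_; anySubset?; ∣⊥∣≡0)
open import Data.Integer.Base as ℤ using (ℤ; +_; -[1+_])
open import Data.Integer.Properties using (∣-i∣≡∣i∣)
open import Data.Nat.Base as ℕ using (ℕ; zero; suc; _≤_; _<_; z≤n; s≤s; _∸_)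
import Data.Nat.Properties as ℕ
open import Data.Nat.Induction using (Acc; acc; <-wellFounded)
open import Data.Product.Base using (Σ-syntax; ∃; ∃-syntax; _×_; _,_; proj₁; proj₂)
open import Data.Sum.Base using (_⊎_; inj₁; inj₂)
open import Data.Vec.Base as Vec using ([]; _∷_; here; there; lookup)
open import Data.Vec.Properties
  using (lookup∘tabulate; lookup⇒[]=; []=⇒lookup)
open import Data.Vec.Functional as Vector using (Vector)
open import Function.Base using (_∘_)
open import Function.Bundles using (Inverse; _⇔_; mk⇔)
open import Level using (Level; _⊔_) renaming (suc to lsuc)
open import Relation.Binary.Definitions using (Decidable; _Respects_)
import Relation.Binary.PropositionalEquality as ≡
open ≡ using (_≡_; _≗_; refl; sym; trans; cong; cong₂; subst)
open import Relation.Nullary using (¬_; Dec; yes; no)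
open import Relation.Nullary.Decidable
  using (_×-dec_; _⊎-dec_; map′; does; dec-true)
open import Relation.Unary using (Pred) renaming (Decidable to Decidable₁)

private
  variable
    p : Level
    n : ℕ

-- k = min { f A : P A }
IsMin : (Subset n → ℕ) → Pred (Subset n) p → ℕ → Set p
IsMin f P k = (∃[ A ] P A × f A ≡ k) × (∀ A → P A → k ≤ f A)

min-exists : (f : Subset n → ℕ) {P : Pred (Subset n) p} → Decidable₁ P →
             ∃ P → ∃[ k ] IsMin f P k
min-exists {n = n} f {P} P? (A , PA) = go A PA (<-wellFounded (f A))
  where
  go : ∀ A → P A → Acc _<_ (f A) → ∃[ k ] IsMin f P k
  go A PA (acc rs) with anySubset? (λ B → P? B ×-dec (f B ℕ.<? f A))
  ... | yes (B , PB , fB<fA) = go B PB (rs fB<fA)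
  ... | no  none = f A , (A , PA , refl) ,
                   λ B PB → ℕ.≮⇒≥ (λ fB<fA → none (B , PB , fB<fA))

IsMin-unique : (f : Subset n → ℕ) {P : Pred (Subset n) p} {j k : ℕ} →
               IsMin f P j → IsMin f P k → j ≡ k
IsMin-unique f ((A , PA , refl) , lbA) ((B , PB , refl) , lbB) =
  ℕ.≤-antisym (lbA B PB) (lbB A PA)

subset-of-size : ∀ {m} → m ≤ n → ∃ λ (A : Subset n) → ∣ A ∣ ≡ m
subset-of-size {n} z≤n = ∅ , ∣⊥∣≡0 n
subset-of-size (s≤s m≤n) with subset-of-size m≤n
... | A , ∣A∣≡m = inside ∷ A , cong suc ∣A∣≡m

enum : (A : Subset n) → Fin ∣ A ∣ → Fin n
enum (inside  ∷ A) zero    = zero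
enum (inside  ∷ A) (suc i) = suc (enum A i)
enum (outside ∷ A) i       = suc (enum A i)

enum-∈ : (A : Subset n) (i : Fin ∣ A ∣) → enum A i ∈ A
enum-∈ (inside  ∷ A) zero    = here
enum-∈ (inside  ∷ A) (suc i) = there (enum-∈ A i)
enum-∈ (outside ∷ A) i       = there (enum-∈ A i)

enum-injective : (A : Subset n) {i j : Fin ∣ A ∣} → enum A i ≡ enum A j → i ≡ j
enum-injective (inside  ∷ A) {zero}  {zero}  _  = refl
enum-injective (inside  ∷ A) {suc i} {suc j} eq =
  cong suc (enum-injective A (suc-injective eq))
enum-injective (outside ∷ A) eq = enum-injective A (suc-injective eq)

enum-surjective : (A : Subset n) {x : Fin n} → x ∈ A → ∃[ i ] enum A i ≡ x
enum-surjective (inside  ∷ A) here        = zero , refl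
enum-surjective (inside  ∷ A) (there x∈A) with enum-surjective A x∈A
... | i , eq = suc i , cong suc eq
enum-surjective (outside ∷ A) (there x∈A) with enum-surjective A x∈A
... | i , eq = i , cong suc eq

open Summation ℕ.+-0-commutativeMonoid using () renaming (sum to sumℕ)

‖_‖₁ : ∀ {m} → Vector ℤ m → ℕ
‖ l ‖₁ = sumℕ (λ i → ℤ.∣ l i ∣)

-- Vectors are functions, so a predicate can only be decided up to _≗_.
any-of-norm? : ∀ m h {Q : Pred (Vector ℤ m) p} → Q Respects _≗_ →
               Decidable₁ Q → Dec (∃[ l ] ‖ l ‖₁ ≡ h × Q l)
any-of-norm? zero h {Q} resp Q? =
  map′ (λ (0≡h , q) → Vector.[] , 0≡h , q)
       (λ (l , 0≡h , q) → 0≡h , resp (λ ()) q)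
       ((0 ℕ.≟ h) ×-dec Q? Vector.[])
any-of-norm? {p = p} (suc m) h {Q} resp Q? =
  map′ to from (any? (λ j → step? (+ toℕ j) (toℕ j) ⊎-dec
                            step? (ℤ.- (+ toℕ j)) (toℕ j)))
  where
  Step : ℤ → ℕ → Set p
  Step c j = ∃[ l ] ‖ l ‖₁ ≡ h ∸ j × Q (c Vector.∷ l)

  ∷-cong : ∀ {c} {l l′ : Vector ℤ m} → l ≗ l′ → (c Vector.∷ l) ≗ (c Vector.∷ l′)
  ∷-cong eq zero    = refl
  ∷-cong eq (suc i) = eq i

  η : (l : Vector ℤ (suc m)) → l ≗ (Vector.head l Vector.∷ Vector.tail l)
  η l zero    = refl
  η l (suc i) = refl

  step? : ∀ c j → Dec (Step c j)
  step? c j = any-of-norm? m (h ∸ j) (resp ∘ ∷-cong) (λ l → Q? (c Vector.∷ l))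

  Search : Set p
  Search = Σ[ j ∈ Fin (suc h) ]
             (Step (+ toℕ j) (toℕ j) ⊎ Step (ℤ.- (+ toℕ j)) (toℕ j))

  glue : ∀ c (j : Fin (suc h)) → ℤ.∣ c ∣ ≡ toℕ j → Step c (toℕ j) →
         ∃[ l ] ‖ l ‖₁ ≡ h × Q l
  glue c j ∣c∣≡j (l , eq , q) =
    c Vector.∷ l ,
    trans (cong₂ ℕ._+_ ∣c∣≡j eq) (ℕ.m+[n∸m]≡n (ℕ.≤-pred (toℕ<n j))) , q

  to : Search → ∃[ l ] ‖ l ‖₁ ≡ h × Q l
  to (j , inj₁ s) = glue (+ toℕ j) j refl s
  to (j , inj₂ s) = glue (ℤ.- (+ toℕ j)) j (∣-i∣≡∣i∣ (+ toℕ j)) s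

  sign : ∀ c → c ≡ + ℤ.∣ c ∣ ⊎ c ≡ ℤ.- (+ ℤ.∣ c ∣)
  sign (+ _)    = inj₁ refl
  sign -[1+ _ ] = inj₂ refl

  from : (∃[ l ] ‖ l ‖₁ ≡ h × Q l) → Search
  from (l , eq , q) = j , side (sign c)
    where
    c = Vector.head l
    t = Vector.tail l

    c≤h : ℤ.∣ c ∣ < suc h
    c≤h = s≤s (subst (ℤ.∣ c ∣ ≤_) eq (ℕ.m≤m+n ℤ.∣ c ∣ ‖ t ‖₁))

    j : Fin (suc h)
    j = fromℕ< c≤h

    j≡ : toℕ j ≡ ℤ.∣ c ∣
    j≡ = toℕ-fromℕ< c≤h

    rest : ‖ t ‖₁ ≡ h ∸ toℕ j
    rest = trans (sym (ℕ.m+n∸m≡n ℤ.∣ c ∣ ‖ t ‖₁)) (cong₂ _∸_ eq (sym j≡))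

    move : ∀ {d} → c ≡ d → Step d (toℕ j)
    move refl = t , rest , resp (η l) q

    side : c ≡ + ℤ.∣ c ∣ ⊎ c ≡ ℤ.- (+ ℤ.∣ c ∣) →
           Step (+ toℕ j) (toℕ j) ⊎ Step (ℤ.- (+ toℕ j)) (toℕ j)
    side (inj₁ e) = inj₁ (move (trans e (cong +_ (sym j≡))))
    side (inj₂ e) = inj₂ (move (trans e (cong (λ k → ℤ.- (+ k)) (sym j≡))))

record FiniteAbelianGroup c ℓ : Set (lsuc (c ⊔ ℓ)) where
  field
    abelianGroup : AbelianGroup c ℓ

  open AbelianGroup abelianGroup public
    renaming
    ( _∙_ to infixl 6 _+_
    ; ε   to 0#
    ; _⁻¹ to infix 8 -_
    ; _-_ to infixl 6 _∸ᴳ_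
    )

  field
    order       : ℕ
    enumeration : Inverse setoid (≡.setoid (Fin order))

  open Inverse enumeration public
    using ()
    renaming (to to index; from to element; to-cong to index-cong)

  element-index : ∀ x → element (index x) ≈ x
  element-index = Inverse.strictlyInverseʳ enumeration

  index-element : ∀ i → index (element i) ≡ i
  index-element = Inverse.strictlyInverseˡ enumeration

module _ {c ℓ} (G : FiniteAbelianGroup c ℓ) where

  open FiniteAbelianGroup G hiding (refl; sym; trans)
  open FiniteAbelianGroup G using () renaming (refl to ≈-refl; sym to ≈-sym; trans to ≈-trans)
  open Summation commutativeMonoid using (sum; sum-cong-≋)
  open Multiplication monoid using () renaming (_×_ to _×ℕ_)

  _·_ : ℤ → Carrier → Carrier
  (+ k)    · x = k ×ℕ x
  -[1+ k ] · x = - (suc k ×ℕ x)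

  -- A subset of the group is given by the indices of its elements; every
  -- subset with a cardinality arises this way, since it is decidable.
  SubsetOf : Set
  SubsetOf = Subset order

  infix 4 _∈ᴳ_
  _∈ᴳ_ : Carrier → SubsetOf → Set
  x ∈ᴳ A = index x ∈ A

  _≈?_ : Decidable _≈_
  x ≈? y = map′ injective index-cong (index x ≟ᶠ index y)
    where injective : index x ≡ index y → x ≈ y
          injective eq = ≈-trans (≈-sym (element-index x))
            (≈-trans (reflexive (cong element eq)) (element-index y))

  comprehension : {P : Pred Carrier p} → Decidable₁ P → SubsetOf
  comprehension P? = Vec.tabulate (λ i → does (P? (element i)))

  ∈-comprehension⁺ : {P : Pred Carrier p} (P? : Decidable₁ P) →
                     P Respects _≈_ → ∀ {x} → P x → x ∈ᴳ comprehension P?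
  ∈-comprehension⁺ P? resp {x} Px = lookup⇒[]= (index x) _
    (trans (lookup∘tabulate _ (index x))
           (dec-true (P? _) (resp (≈-sym (element-index x)) Px)))

  ∈-comprehension⁻ : {P : Pred Carrier p} (P? : Decidable₁ P) →
                     P Respects _≈_ → ∀ {x} → x ∈ᴳ comprehension P? → P x
  ∈-comprehension⁻ {P = P} P? resp {x} x∈ =
    resp (element-index x) (extract (P? (element (index x)))
      (trans (sym (lookup∘tabulate _ (index x))) ([]=⇒lookup x∈)))
    where
    extract : ∀ {y} (d : Dec (P y)) → does d ≡ inside → P y
    extract (yes Py) _ = Py

  IsNegative : SubsetOf → Pred Carrier ℓ
  IsNegative A x = ∃[ i ] i ∈ A × x ≈ - element i

  isNegative? : ∀ A → Decidable₁ (IsNegative A)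
  isNegative? A x = any? (λ i → (i ∈? A) ×-dec (x ≈? (- element i)))

  negate : SubsetOf → SubsetOf
  negate A = comprehension (isNegative? A)

  ∈-negate⇔ : ∀ A {x} → x ∈ᴳ negate A ⇔ IsNegative A x
  ∈-negate⇔ A = mk⇔ (∈-comprehension⁻ (isNegative? A) resp)
                    (∈-comprehension⁺ (isNegative? A) resp)
    where
    resp : IsNegative A Respects _≈_
    resp x≈y (i , i∈A , x≈) = i , i∈A , ≈-trans (≈-sym x≈y) x≈

  Symmetric : Pred SubsetOf _
  Symmetric A = A ≡ negate A

  NearSymmetric : Pred SubsetOf _
  NearSymmetric A = ¬ Symmetric A × (∃[ i ] i ∈ A × Symmetric (A - i))

  Asymmetric : Pred SubsetOf _
  Asymmetric A = Empty (A ∩ negate A)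

  𝒜 : ℕ → Pred SubsetOf _
  𝒜 m A = ∣ A ∣ ≡ m × (Symmetric A ⊎ NearSymmetric A ⊎ Asymmetric A)

  combination : (A : SubsetOf) → Vector ℤ ∣ A ∣ → Carrier
  combination A l = sum (λ i → l i · element (enum A i))

  IsSignedSum : ℕ → SubsetOf → Pred Carrier ℓ
  IsSignedSum h A x = ∃[ l ] ‖ l ‖₁ ≡ h × x ≈ combination A l

  isSignedSum? : ∀ h A → Decidable₁ (IsSignedSum h A)
  isSignedSum? h A x = any-of-norm? ∣ A ∣ h resp (λ l → x ≈? combination A l)
    where
    resp : (λ l → x ≈ combination A l) Respects _≗_
    resp l≗l′ x≈ = ≈-trans x≈ (sum-cong-≋ (λ i →
      reflexive (cong (_· element (enum A i)) (l≗l′ i))))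

  signedSumset : ℕ → SubsetOf → SubsetOf
  signedSumset h A = comprehension (isSignedSum? h A)

  ∈-signedSumset⇔ : ∀ h A {x} → x ∈ᴳ signedSumset h A ⇔ IsSignedSum h A x
  ∈-signedSumset⇔ h A = mk⇔ (∈-comprehension⁻ (isSignedSum? h A) resp)
                            (∈-comprehension⁺ (isSignedSum? h A) resp)
    where
    resp : IsSignedSum h A Respects _≈_
    resp x≈y (l , norm , x≈) = l , norm , ≈-trans (≈-sym x≈y) x≈

  -- The bound m ≤ order only serves to make the minimum exist.
  ρ±-exists : ∀ m h → m ≤ order →
              ∃[ k ] IsMin (λ A → ∣ signedSumset h A ∣) (λ A → ∣ A ∣ ≡ m) k
  ρ±-exists m h m≤∣G∣ =
    min-exists _ (λ A → ∣ A ∣ ℕ.≟ m) (subset-of-size m≤∣G∣)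

  ρ± : ∀ m h → m ≤ order → ℕ
  ρ± m h m≤∣G∣ = proj₁ (ρ±-exists m h m≤∣G∣)

  ρ±-isMin : ∀ m h (m≤∣G∣ : m ≤ order) →
             IsMin (λ A → ∣ signedSumset h A ∣) (λ A → ∣ A ∣ ≡ m) (ρ± m h m≤∣G∣)
  ρ±-isMin m h m≤∣G∣ = proj₂ (ρ±-exists m h m≤∣G∣)

{-# OPTIONS --safe #-}

-- If A ∩ -A is empty, A is itself asymmetric.  Otherwise 0 is a sum of two
-- terms of A, so a cancellation in a signed sum can be refilled without
-- changing its value, and h±A consists of all sums of h terms of B = A ∪ -A.
-- Hence h±A′ ⊆ h±A for every A′ ⊆ B.  Deleting orbits {x, -x} from the symmetric
-- set B, and in the last step possibly only one point of an orbit, leads to an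
-- A′ with |A| elements that is symmetric or near-symmetric.

module Submission where

open import Defs
import Algebra.Properties.AbelianGroup as AbelianGroupProperties
import Algebra.Properties.CommutativeMonoid.Sum as Summation
import Algebra.Properties.CommutativeSemigroup as CommutativeSemigroupProperties
open import Data.Fin.Base using (Fin; zero; suc)
open import Data.Fin.Properties using (any?) renaming (_≟_ to _≟ᶠ_)
open import Data.Fin.Subset
  using (Subset; inside; outside; _∈_; _⊆_; _∩_; _∪_; _-_; ∣_∣; Nonempty)
open import Data.Fin.Subset.Properties
  using ( nonempty?; ⊆-antisym; ⊆-refl; ⊆-trans; p⊆q⇒∣p∣≤∣q∣; p─q⊆p; p─⊥≡p
        ; x∈p∧x≢y⇒x∈p-y; x∈p∩q⁻; x∈p∪q⁺; x∈p∪q⁻; ∣p∣≤∣p∪q∣; ∣⊥∣≡0; Empty-unique)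
open import Data.Integer.Base as ℤ using (ℤ; +_; -[1+_]; NonNegative)
open import Data.Integer.Properties using (suc-pred)
open import Data.Nat.Base as ℕ using (zero; suc)
open import Data.Nat using (ℕ; _≤_)
import Data.Nat.Properties as ℕ
open import Data.Product.Base using (∃; ∃-syntax; _×_; _,_)
open import Data.Sum.Base using (_⊎_; inj₁; inj₂)
open import Data.Vec.Base using (_∷_; here; there)
open import Data.Vec.Functional using (Vector; head; tail; updateAt)
open import Function.Base using (_∘_)
open import Function.Bundles using (Equivalence)
open import Level using (_⊔_)
open import Relation.Binary.PropositionalEquality as ≡
  using (_≡_; _≢_; cong; subst)
open import Relation.Nullary using (¬_; Dec; yes; no; contradiction)
open import Relation.Unary using (Pred)
import Relation.Binary.Reasoning.Setoid as SetoidReasoning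

-- Deleting a point from a finite subset.

x∉p-x : ∀ {n} {x : Fin n} (p : Subset n) → ¬ x ∈ p - x
x∉p-x {x = suc x} (_ ∷ p) (there x∈) = x∉p-x p x∈

x∈p⇒1+∣p-x∣≡∣p∣ : ∀ {n} {x : Fin n} {p : Subset n} → x ∈ p → suc ∣ p - x ∣ ≡ ∣ p ∣
x∈p⇒1+∣p-x∣≡∣p∣ {p = inside  ∷ p} here        = cong (suc ∘ ∣_∣) (p─⊥≡p p)
x∈p⇒1+∣p-x∣≡∣p∣ {p = inside  ∷ p} (there x∈p) = cong suc (x∈p⇒1+∣p-x∣≡∣p∣ x∈p)
x∈p⇒1+∣p-x∣≡∣p∣ {p = outside ∷ p} (there x∈p) = x∈p⇒1+∣p-x∣≡∣p∣ x∈p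

∣p∣≡1+k⇒Nonempty : ∀ {n k} (p : Subset n) → ∣ p ∣ ≡ suc k → Nonempty p
∣p∣≡1+k⇒Nonempty {n} p ∣p∣≡ with nonempty? p
... | yes ne    = ne
... | no  empty =
  contradiction (≡.trans (≡.sym ∣p∣≡) (≡.trans (cong ∣_∣ (Empty-unique empty)) (∣⊥∣≡0 n)))
                ℕ.1+n≢0

-- Changing one coefficient of an integer vector.

updateAt-preserves : ∀ {a p} {A : Set a} {n} {P : Pred A p} (xs : Vector A n) i j {f} →
                     P (xs j) → (i ≡ j → P (f (xs j))) → P (updateAt xs i f j)
updateAt-preserves xs zero    zero    Px Pfx = Pfx ≡.refl
updateAt-preserves xs zero    (suc j) Px Pfx = Px
updateAt-preserves xs (suc i) zero    Px Pfx = Px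
updateAt-preserves {P = P} xs (suc i) (suc j) Px Pfx =
  updateAt-preserves {P = P} (tail xs) i j Px (Pfx ∘ cong suc)

norm-0 : ∀ m → ‖ (λ (_ : Fin m) → + 0) ‖₁ ≡ 0
norm-0 zero    = ≡.refl
norm-0 (suc m) = norm-0 m

norm-updateAt-suc : ∀ {n} (l : Vector ℤ n) i {f} →
                    ℤ.∣ f (l i) ∣ ≡ suc ℤ.∣ l i ∣ → ‖ updateAt l i f ‖₁ ≡ suc ‖ l ‖₁
norm-updateAt-suc l zero    eq = cong (ℕ._+ ‖ tail l ‖₁) eq
norm-updateAt-suc l (suc i) eq =
  ≡.trans (cong (ℤ.∣ head l ∣ ℕ.+_) (norm-updateAt-suc (tail l) i eq))
          (ℕ.+-suc ℤ.∣ head l ∣ _)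

norm-updateAt-pred : ∀ {n} (l : Vector ℤ n) i {f} →
                     suc ℤ.∣ f (l i) ∣ ≡ ℤ.∣ l i ∣ → suc ‖ updateAt l i f ‖₁ ≡ ‖ l ‖₁
norm-updateAt-pred l zero    eq = cong (ℕ._+ ‖ tail l ‖₁) eq
norm-updateAt-pred l (suc i) eq =
  ≡.trans (≡.sym (ℕ.+-suc ℤ.∣ head l ∣ _))
          (cong (ℤ.∣ head l ∣ ℕ.+_) (norm-updateAt-pred (tail l) i eq))

-- The two effects of a unit step on an absolute value: away from zero it adds a term, towards zero
-- it cancels one.
Neighbours : ℕ → ℕ → Set
Neighbours j k = j ≡ suc k ⊎ suc j ≡ k

∣suc∣ : ∀ z → Neighbours ℤ.∣ ℤ.suc z ∣ ℤ.∣ z ∣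
∣suc∣ (+ k)          = inj₁ ≡.refl
∣suc∣ -[1+ zero ]    = inj₂ ≡.refl
∣suc∣ -[1+ suc k ]   = inj₂ ≡.refl

∣pred∣ : ∀ z → Neighbours ℤ.∣ ℤ.pred z ∣ ℤ.∣ z ∣
∣pred∣ (+ zero)  = inj₁ ≡.refl
∣pred∣ (+ suc k) = inj₂ ≡.refl
∣pred∣ -[1+ k ]  = inj₁ ≡.refl

∣suc∣-nonNeg : ∀ z → NonNegative z → ℤ.∣ ℤ.suc z ∣ ≡ suc ℤ.∣ z ∣
∣suc∣-nonNeg (+ k) _ = ≡.refl

suc-nonNeg : ∀ z → NonNegative z → NonNegative (ℤ.suc z)
suc-nonNeg (+ k) _ = _

module _ {c ℓ} (G : FiniteAbelianGroup c ℓ) where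

  open FiniteAbelianGroup G
  open Summation commutativeMonoid using (sum)
  open AbelianGroupProperties abelianGroup
    using (⁻¹-involutive; ε⁻¹≈ε; ⁻¹-∙-comm; \\-leftDividesˡ; \\-leftDividesʳ)
  open CommutativeSemigroupProperties commutativeSemigroup using (x∙yz≈y∙xz)
  open SetoidReasoning setoid

  -- Integer multiples and linear combinations.

  infixr 7 _•_
  _•_ : ℤ → Carrier → Carrier
  _•_ = _·_ G

  suc-• : ∀ z x → ℤ.suc z • x ≈ x + z • x
  suc-• (+ k)        x = refl
  suc-• -[1+ zero ]  x = sym (trans (∙-congˡ (⁻¹-cong (identityʳ x))) (inverseʳ x))
  suc-• -[1+ suc k ] x = sym (trans (∙-congˡ (sym (⁻¹-∙-comm x _))) (\\-leftDividesˡ x _))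

  pred-• : ∀ z x → ℤ.pred z • x ≈ - x + z • x
  pred-• z x = begin
    ℤ.pred z • x                     ≈⟨ \\-leftDividesʳ x _ ⟨
    - x + (x + ℤ.pred z • x)         ≈⟨ ∙-congˡ (suc-• (ℤ.pred z) x) ⟨
    - x + ℤ.suc (ℤ.pred z) • x       ≡⟨ cong (λ w → - x + w • x) (suc-pred z) ⟩
    - x + z • x                      ∎

  linear : ∀ {n} → Vector Carrier n → Vector ℤ n → Carrier
  linear a l = sum (λ i → l i • a i)

  linear-0 : ∀ {m} (b : Vector Carrier m) → 0# ≈ linear b (λ _ → + 0)
  linear-0 {zero}  b = refl
  linear-0 {suc m} b = trans (linear-0 (tail b)) (sym (identityˡ _))

  -- `y` is left free to cover both unit steps: `a i` for `ℤ.suc` and `- a i` for `ℤ.pred`.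
  linear-updateAt : ∀ {n} (a : Vector Carrier n) l i {f y} →
                    f (l i) • a i ≈ y + l i • a i →
                    linear a (updateAt l i f) ≈ y + linear a l
  linear-updateAt a l zero    eq = trans (∙-congʳ eq) (assoc _ _ _)
  linear-updateAt a l (suc i) eq =
    trans (∙-congˡ (linear-updateAt (tail a) (tail l) i eq)) (x∙yz≈y∙xz _ _ _)

  -- Sums of a fixed number of terms.

  ±_ : ∀ {n} → Vector Carrier n → Pred Carrier ℓ
  (± a) x = ∃[ i ] (x ≈ a i ⊎ x ≈ - a i)

  ±-neg : ∀ {n} {a : Vector Carrier n} {x y} → y ≈ - x → (± a) x → (± a) y
  ±-neg y≈ (i , inj₁ x≈) = i , inj₂ (trans y≈ (⁻¹-cong x≈))
  ±-neg y≈ (i , inj₂ x≈) = i , inj₁ (trans y≈ (trans (⁻¹-cong x≈) (⁻¹-involutive _)))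

  infixr 5 _∷_
  -- The `n`-fold sumset of `P`, repetitions allowed. The constructors carry equations because
  -- values matter only up to `≈`.
  data Sums (P : Pred Carrier ℓ) : ℕ → Pred Carrier (c ⊔ ℓ) where
    []  : ∀ {x} → x ≈ 0# → Sums P 0 x
    _∷_ : ∀ {n x y z} → P x × z ≈ x + y → Sums P n y → Sums P (suc n) z

  Sums-resp : ∀ {P n x y} → x ≈ y → Sums P n x → Sums P n y
  Sums-resp x≈y ([] x≈)         = [] (trans (sym x≈y) x≈)
  Sums-resp x≈y ((Px , x≈) ∷ s) = (Px , trans (sym x≈y) x≈) ∷ s

  Sums-+ : ∀ {P m n x y} → Sums P m x → Sums P n y → Sums P (m ℕ.+ n) (x + y)
  Sums-+ ([] x≈0)        t = Sums-resp (sym (trans (∙-congʳ x≈0) (identityˡ _))) t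
  Sums-+ ((Px , x≈) ∷ s) t = (Px , trans (∙-congʳ x≈) (assoc _ _ _)) ∷ Sums-+ s t

  Sums-× : ∀ {P x} k → P x → Sums P k ((+ k) • x)
  Sums-× zero    Px = [] refl
  Sums-× (suc k) Px = (Px , refl) ∷ Sums-× k Px

  neg-× : ∀ k x → - ((+ k) • x) ≈ (+ k) • (- x)
  neg-× zero    x = ε⁻¹≈ε
  neg-× (suc k) x = trans (sym (⁻¹-∙-comm x _)) (∙-congˡ (neg-× k x))

  -- Sums over `± a` and signed sums over `a`.

  module _ {n} (a : Vector Carrier n) where

    -- A negative coefficient is paid for with copies of `- x`, which again lies in `± a`.
    Sums-• : ∀ z {x} → (± a) x → Sums (± a) ℤ.∣ z ∣ (z • x)
    Sums-• (+ k)        ±x = Sums-× k ±x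
    Sums-• -[1+ k ] {x} ±x =
      Sums-resp (sym (neg-× (suc k) x)) (Sums-× (suc k) (±-neg refl ±x))

    linear⇒Sums : ∀ {m} (b : Vector Carrier m) → (∀ i → (± a) (b i)) →
                  ∀ l → Sums (± a) ‖ l ‖₁ (linear b l)
    linear⇒Sums {zero}  b b⊆±a l = [] refl
    linear⇒Sums {suc m} b b⊆±a l =
      Sums-+ (Sums-• (head l) (b⊆±a zero)) (linear⇒Sums (tail b) (b⊆±a ∘ suc) (tail l))

    -- `j` may equal `i`, so an entry with `a i ≈ - a i` counts as reflected.
    Reflected : Pred (Fin n) ℓ
    Reflected i = ∃[ j ] a j ≈ - a i

    reflected? : ∀ i → Dec (Reflected i)
    reflected? i = any? (λ j → _≈?_ G (a j) (- a i))

    reflect : ∀ {i j} → a j ≈ - a i → Reflected j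
    reflect {i} eq = i , sym (trans (⁻¹-cong eq) (⁻¹-involutive _))

    -- Nonnegativity at the reflected indices makes it possible to increase
    -- the coefficients there without any cancellation.
    Representation : ℕ → Pred Carrier ℓ
    Representation k x =
      ∃[ l ] ‖ l ‖₁ ≡ k × x ≈ linear a l × (∀ {i} → Reflected i → NonNegative (l i))

    Representation-resp : ∀ {k x y} → y ≈ x → Representation k x → Representation k y
    Representation-resp y≈x (l , norm , x≈ , nonNeg) = l , norm , trans y≈x x≈ , nonNeg

    raise : ∀ {i k x} → Reflected i → Representation k x → Representation (suc k) (a i + x)
    raise {i} r (l , norm , x≈ , nonNeg) =
      updateAt l i ℤ.suc ,
      ≡.trans (norm-updateAt-suc l i (∣suc∣-nonNeg (l i) (nonNeg r))) (cong suc norm) ,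
      trans (∙-congˡ x≈) (sym (linear-updateAt a l i (suc-• (l i) (a i)))) ,
      λ {j} s → updateAt-preserves {P = NonNegative} l i j (nonNeg s)
                  (λ _ → suc-nonNeg (l j) (nonNeg s))

    module _ (reflected : ∃ Reflected) where

      -- Adding `a j + a i ≈ 0#` leaves the value alone. Both indices are reflected, so each raise
      -- costs exactly one unit of norm.
      refill : ∀ {k x} → Representation k x → Representation (suc (suc k)) x
      refill {x = x} r = let (i , j , eq) = reflected in
        Representation-resp
          (sym (trans (∙-congʳ eq) (\\-leftDividesʳ (a i) x)))
          (raise (reflect eq) (raise (j , eq) r))

      -- An unreflected coefficient may have either sign, so a step can lower the norm; refilling
      -- then makes up the loss. Nonnegativity survives because no reflected index is touched.
      shift : ∀ f {i k x y} → ¬ Reflected i →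
              (∀ z → Neighbours ℤ.∣ f z ∣ ℤ.∣ z ∣) → (∀ z → f z • a i ≈ y + z • a i) →
              Representation k x → Representation (suc k) (y + x)
      shift f {i} {k} {x} {y} ¬r ∣f∣ f-• (l , norm , x≈ , nonNeg) = by-cases (∣f∣ (l i))
        where
        l′ = updateAt l i f

        l′-rep : ∀ {j} → ‖ l′ ‖₁ ≡ j → Representation j (y + x)
        l′-rep eq =
          l′ , eq , trans (∙-congˡ x≈) (sym (linear-updateAt a l i (f-• (l i)))) ,
          λ {j} s → updateAt-preserves {P = NonNegative} l i j (nonNeg s)
                      (λ i≡j → contradiction (subst Reflected (≡.sym i≡j) s) ¬r)

        by-cases : Neighbours ℤ.∣ f (l i) ∣ ℤ.∣ l i ∣ → Representation (suc k) (y + x)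
        by-cases (inj₁ up)   =
          l′-rep (≡.trans (norm-updateAt-suc l i up) (cong suc norm))
        by-cases (inj₂ down) =
          -- The norm of `l′` is one below `k`; the two refilled terms bring it to `suc k`.
          subst (λ j → Representation (suc j) (y + x))
                (≡.trans (norm-updateAt-pred l i down) norm)
                (refill (l′-rep ≡.refl))

      -- At a reflected index, a term `- a i` is added as `a j`, so no coefficient there ever
      -- decreases. Elsewhere either sign is a unit step handled by `shift`.
      prepend : ∀ {k x y} → (± a) x → Representation k y → Representation (suc k) (x + y)
      prepend (i , ±x) r with reflected? i
      prepend (i , inj₁ x≈) r | yes ref =
        Representation-resp (∙-congʳ x≈) (raise ref r)
      prepend (i , inj₂ x≈) r | yes (j , eq) =
        Representation-resp (∙-congʳ (trans x≈ (sym eq))) (raise (reflect eq) r)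
      prepend (i , inj₁ x≈) r | no ¬ref =
        Representation-resp (∙-congʳ x≈) (shift ℤ.suc ¬ref ∣suc∣ (λ z → suc-• z (a i)) r)
      prepend (i , inj₂ x≈) r | no ¬ref =
        Representation-resp (∙-congʳ x≈) (shift ℤ.pred ¬ref ∣pred∣ (λ z → pred-• z (a i)) r)

      Sums⇒Representation : ∀ {k x} → Sums (± a) k x → Representation k x
      Sums⇒Representation ([] x≈0)        =
        (λ _ → + 0) , norm-0 n , trans x≈0 (linear-0 a) , λ _ → _
      Sums⇒Representation ((±x , z≈) ∷ s) =
        Representation-resp z≈ (prepend ±x (Sums⇒Representation s))

  -- Signed sumsets of subsets of the symmetrization.

  open Equivalence using (to; from)

  elements : ∀ A → Vector Carrier ∣ A ∣
  elements A = element ∘ enum A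

  element-∈ᴳ : ∀ {A i} → i ∈ A → _∈ᴳ_ G (element i) A
  element-∈ᴳ {A} {i} = subst (_∈ A) (≡.sym (index-element i))

  ∈-negate : ∀ A {i} → i ∈ negate G A → ∃[ j ] j ∈ A × element i ≈ - element j
  ∈-negate A i∈ = to (∈-negate⇔ G A) (element-∈ᴳ i∈)

  ∈⇒± : ∀ A {i} → i ∈ A → (± elements A) (element i)
  ∈⇒± A i∈A with enum-surjective A i∈A
  ... | j , ≡.refl = j , inj₁ refl

  symmetrization : SubsetOf G → SubsetOf G
  symmetrization A = A ∪ negate G A

  ∈-symmetrization⇒± : ∀ A {i} → i ∈ symmetrization A → (± elements A) (element i)
  ∈-symmetrization⇒± A i∈ with x∈p∪q⁻ A (negate G A) i∈
  ... | inj₁ i∈A  = ∈⇒± A i∈A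
  ... | inj₂ i∈-A with ∈-negate A i∈-A
  ...   | j , j∈A , eq = ±-neg eq (∈⇒± A j∈A)

  -- A signed sum over `A′` is a sum of `h` terms from `A` and its negatives, which is rewritten
  -- over `A`. The common point of `A` and `negate G A` supplies the reflected index needed for
  -- refilling.
  signedSumset-⊆ : ∀ h A A′ → Nonempty (A ∩ negate G A) → A′ ⊆ symmetrization A →
                   signedSumset G h A′ ⊆ signedSumset G h A
  signedSumset-⊆ h A A′ (i , i∈) A′⊆ {x} x∈
    with x∈p∩q⁻ A (negate G A) i∈
  ... | i∈A , i∈-A with ∈-negate A i∈-A
  ... | j , j∈A , eq with enum-surjective A i∈A | enum-surjective A j∈A
  ... | p , ≡.refl | q , ≡.refl
    with to (∈-signedSumset⇔ G h A′) (element-∈ᴳ x∈)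
  ... | l′ , norm′ , x≈′
    with Sums⇒Representation (elements A) (q , p , eq)
           (linear⇒Sums (elements A) (elements A′)
              (λ k → ∈-symmetrization⇒± A (A′⊆ (enum-∈ A′ k))) l′)
  ... | l , norm , x≈ , _ =
    subst (_∈ signedSumset G h A) (index-element x)
      (from (∈-signedSumset⇔ G h A) (l , ≡.trans norm norm′ , trans x≈′ x≈))

  -- Symmetry as closure under negation.

  neg : Fin order → Fin order
  neg i = index (- element i)

  neg-involutive : ∀ i → neg (neg i) ≡ i
  neg-involutive i = ≡.trans
    (index-cong (trans (⁻¹-cong (element-index _)) (⁻¹-involutive _))) (index-element i)

  -- A one-sided form of symmetry, easier to maintain under deletions; it suffices because `neg` is
  -- an involution.
  Closed : Pred (SubsetOf G) _
  Closed A = ∀ {i} → i ∈ A → neg i ∈ A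

  neg∈⇒∈-negate : ∀ A {i} → neg i ∈ A → i ∈ negate G A
  neg∈⇒∈-negate A {i} ni∈A = subst (_∈ negate G A) (index-element i)
    (from (∈-negate⇔ G A)
      (neg i , ni∈A , sym (trans (⁻¹-cong (element-index _)) (⁻¹-involutive _))))

  ∈-negate⇒neg∈ : ∀ A {i} → i ∈ negate G A → neg i ∈ A
  ∈-negate⇒neg∈ A i∈ with ∈-negate A i∈
  ... | j , j∈A , eq = subst (_∈ A)
    (≡.sym (≡.trans (index-cong (trans (⁻¹-cong eq) (⁻¹-involutive _))) (index-element j))) j∈A

  Closed⇒Symmetric : ∀ {A} → Closed A → Symmetric G A
  Closed⇒Symmetric {A} closed = ⊆-antisym (neg∈⇒∈-negate A ∘ closed)
    (λ i∈ → subst (_∈ A) (neg-involutive _) (closed (∈-negate⇒neg∈ A i∈)))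

  Symmetric⇒Closed : ∀ {A} → Symmetric G A → Closed A
  Symmetric⇒Closed {A} A≡-A i∈A = ∈-negate⇒neg∈ A (subst (_ ∈_) A≡-A i∈A)

  symmetrization-closed : ∀ A → Closed (symmetrization A)
  symmetrization-closed A i∈ with x∈p∪q⁻ A (negate G A) i∈
  ... | inj₁ i∈A  = x∈p∪q⁺ (inj₂ (neg∈⇒∈-negate A (subst (_∈ A) (≡.sym (neg-involutive _)) i∈A)))
  ... | inj₂ i∈-A = x∈p∪q⁺ (inj₁ (∈-negate⇒neg∈ A i∈-A))

  -- Deleting orbits from a symmetric set.

  ∈-minus : ∀ {n} {x y : Fin n} p → x ∈ p - y → x ∈ p × x ≢ y
  ∈-minus p x∈ = p─q⊆p p _ x∈ , λ { ≡.refl → x∉p-x p x∈ }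

  Closed-minus-fixed : ∀ {A i} → Closed A → neg i ≡ i → Closed (A - i)
  Closed-minus-fixed {A} {i} closed fixed {j} j∈ with ∈-minus A j∈
  ... | j∈A , j≢i = x∈p∧x≢y⇒x∈p-y (closed j∈A)
    (λ nj≡i → j≢i (≡.trans (≡.sym (neg-involutive j)) (≡.trans (cong neg nj≡i) fixed)))

  Closed-minus-pair : ∀ {A i} → Closed A → Closed (A - i - neg i)
  Closed-minus-pair {A} {i} closed {j} j∈ with ∈-minus (A - i) j∈
  ... | j∈A-i , j≢ni with ∈-minus A j∈A-i
  ... | j∈A , j≢i = x∈p∧x≢y⇒x∈p-y
    (x∈p∧x≢y⇒x∈p-y (closed j∈A)
      (λ nj≡i → j≢ni (≡.trans (≡.sym (neg-involutive j)) (cong neg nj≡i))))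
    (λ nj≡ni → j≢i (≡.trans (≡.sym (neg-involutive j))
                      (≡.trans (cong neg nj≡ni) (neg-involutive i))))

  -- In `A - i` the point `neg i` has lost its partner, which breaks symmetry; deleting it too
  -- removes the whole orbit.
  minus-nearSymmetric : ∀ {A i} → Closed A → i ∈ A → neg i ≢ i → NearSymmetric G (A - i)
  minus-nearSymmetric {A} {i} closed i∈A ni≢i =
    (λ symmetric → x∉p-x A
      (subst (_∈ A - i) (neg-involutive i) (Symmetric⇒Closed symmetric ni∈A-i))) ,
    neg i , ni∈A-i , Closed⇒Symmetric (Closed-minus-pair closed)
    where
    ni∈A-i : neg i ∈ A - i
    ni∈A-i = x∈p∧x≢y⇒x∈p-y (closed i∈A) ni≢i

  -- `d` counts the points still to be deleted: a fixed point of `neg` uses up one, a two-point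
  -- orbit two.
  closed-shrink : ∀ {m} d A → Closed A → ∣ A ∣ ≡ d ℕ.+ m → ∃[ A′ ] A′ ⊆ A × 𝒜 G m A′
  closed-shrink zero    A closed ∣A∣≡ =
    A , ⊆-refl , ∣A∣≡ , inj₁ (Closed⇒Symmetric closed)
  closed-shrink {m} (suc d) A closed ∣A∣≡ with ∣p∣≡1+k⇒Nonempty A ∣A∣≡
  ... | i , i∈A = by-cases d ∣A-i∣≡ (neg i ≟ᶠ i)
    where
    ∣A-i∣≡ : ∣ A - i ∣ ≡ d ℕ.+ m
    ∣A-i∣≡ = ℕ.suc-injective (≡.trans (x∈p⇒1+∣p-x∣≡∣p∣ i∈A) ∣A∣≡)

    -- Here `d` counts the deletions left after `i`; it is a fresh argument so that the two-point
    -- case can split on it.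
    by-cases : ∀ d → ∣ A - i ∣ ≡ d ℕ.+ m → Dec (neg i ≡ i) → ∃[ A′ ] A′ ⊆ A × 𝒜 G m A′
    by-cases d eq (yes fixed) with closed-shrink d (A - i) (Closed-minus-fixed closed fixed) eq
    ... | A′ , A′⊆ , A′∈𝒜 = A′ , ⊆-trans A′⊆ (p─q⊆p A _) , A′∈𝒜
    -- The deletions run out halfway through an orbit, and `neg i` stays behind.
    by-cases zero    eq (no ni≢i) =
      A - i , p─q⊆p A _ , eq , inj₂ (inj₁ (minus-nearSymmetric closed i∈A ni≢i))
    by-cases (suc d) eq (no ni≢i)
      with closed-shrink d (A - i - neg i) (Closed-minus-pair closed)
             (ℕ.suc-injective
               (≡.trans (x∈p⇒1+∣p-x∣≡∣p∣ (x∈p∧x≢y⇒x∈p-y (closed i∈A) ni≢i)) eq))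
    ... | A′ , A′⊆ , A′∈𝒜 =
      A′ , ⊆-trans A′⊆ (⊆-trans (p─q⊆p (A - i) _) (p─q⊆p A _)) , A′∈𝒜

  𝒜-improves : ∀ h A → ∃[ A′ ] 𝒜 G ∣ A ∣ A′ × ∣ signedSumset G h A′ ∣ ≤ ∣ signedSumset G h A ∣
  𝒜-improves h A with nonempty? (A ∩ negate G A)
  ... | no  empty = A , (≡.refl , inj₂ (inj₂ empty)) , ℕ.≤-refl
  ... | yes ne
    -- The symmetrization is at least as large as `A`, so the truncated difference is the true
    -- excess.
    with closed-shrink (∣ symmetrization A ∣ ℕ.∸ ∣ A ∣) (symmetrization A)
           (symmetrization-closed A) (≡.sym (ℕ.m∸n+n≡m (∣p∣≤∣p∪q∣ A (negate G A))))
  ... | A′ , A′⊆ , A′∈𝒜 =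
    A′ , A′∈𝒜 , p⊆q⇒∣p∣≤∣q∣ (signedSumset-⊆ h A A′ ne A′⊆)

theorem3 : ∀ {c ℓ} (G : FiniteAbelianGroup c ℓ) (m : ℕ) → 1 ≤ m → (m≤∣G∣ : m ≤ FiniteAbelianGroup.order G) →
    (h : ℕ) → 2 ≤ h →
    IsMin (λ A → ∣ signedSumset G h A ∣) (𝒜 G m) (ρ± G m h m≤∣G∣)
theorem3 G m 1≤m m≤∣G∣ h 2≤h with ρ±-isMin G m h m≤∣G∣
... | (A , ≡.refl , attained) , bound with 𝒜-improves G h A
... | A′ , A′∈𝒜@(∣A′∣≡ , _) , le =
  (A′ , A′∈𝒜 , ℕ.≤-antisym (ℕ.≤-trans le (ℕ.≤-reflexive attained)) (bound A′ ∣A′∣≡)) ,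
  λ B (∣B∣≡ , _) → bound B ∣B∣≡
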